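{- Let $\pi = \lambda \oplus \rho$ where $\lambda$ and $\rho$ are permutations with $|\lambda| \ge 2$ and $|\rho| \ge 2$. Then the class $\operatorname{Av}(\pi)$ is not deflatable.
   Context: A permutation $\alpha$ is contained in $\beta$ if $\beta$ has a subsequence in the same relative order as $\alpha$; a class is a set of permutations closed under taking contained permutations; $\operatorname{Av}(\pi)$ is the class of permutations not containing $\pi$. $\alpha\oplus\beta$ is the permutation consisting of a copy of $\alpha$ followed by a copy of $\beta$ whose entries are all larger than those of the copy of $\alpha$. An interval of a permutation is a set of entries whose positions and values each form a set of consecutive integers, the whole permutation not counting as an interval; a permutation is simple if all its intervals are single entries (so $1$, $12$, $21$ are simple). A class $\mathcal{C}$ is deflatable if there is a proper subclass $\mathcal{D}\subsetneq\mathcal{C}$ with $\mathcal{C}\subseteq\langle\mathcal{D}\rangle$, where the substitution closure $\langle\mathcal{D}\rangle$ is the largest class whose simple permutations are exactly those of $\mathcal{D}$; equivalently, $\mathcal{C}$ is not deflatable if and only if every permutation in $\mathcal{C}$ is contained in some simple permutation belonging to $\mathcal{C}$. -}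

module Defs where

open import Data.Nat using (ℕ; zero; suc; _≤_; _∸_)
open import Data.Fin using (Fin; toℕ; splitAt; join)
import Data.Fin as F
open import Data.Fin.Properties using (splitAt-join; join-splitAt)
open import Data.Sum using (_⊎_; inj₁; inj₂)
import Data.Sum as Sum
open import Data.Product using (Σ; _×_; _,_; ∃)
open import Data.Empty using (⊥)
open import Relation.Nullary using (¬_)
open import Relation.Binary.PropositionalEquality using (_≡_; refl; cong; sym; trans)
open import Function.Definitions using (Injective)

-- A permutation of length len: an injective (hence bijective) map
-- from positions Fin len to values Fin len.
record Perm : Set where
  constructor perm
  field
    len : ℕ
    fun : Fin len → Fin len
    inj : Injective _≡_ _≡_ fun
open Perm public

_≼_ : Perm → Perm → Set
α ≼ β = Σ (Fin (len α) → Fin (len β)) λ e →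
          (∀ i j → i F.< j → e i F.< e j)
        × (∀ i j → (fun α i F.< fun α j → fun β (e i) F.< fun β (e j))
                 × (fun β (e i) F.< fun β (e j) → fun α i F.< fun α j))

IsClass : (Perm → Set) → Set
IsClass C = ∀ α β → α ≼ β → C β → C α

Av : Perm → Perm → Set
Av π σ = ¬ (π ≼ σ)

-- The block of positions a..b (a ≤ b) of σ is an interval: its values form
-- a set of consecutive integers, i.e. every entry whose value lies between
-- two values of the block belongs to the block.
IsIntervalBlock : (σ : Perm) → Fin (len σ) → Fin (len σ) → Set
IsIntervalBlock σ a b =
  a F.≤ b ×
  (∀ i j k → a F.≤ i → i F.≤ b → a F.≤ j → j F.≤ b →
     fun σ i F.≤ fun σ k → fun σ k F.≤ fun σ j →
     a F.≤ k × k F.≤ b)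

IsSimple : Perm → Set
IsSimple σ = (1 ≤ len σ) ×
  (∀ a b → IsIntervalBlock σ a b →
     (a ≡ b) ⊎ ((toℕ a ≡ 0) × (toℕ b ≡ len σ ∸ 1)))

-- Substitution closure ⟨D⟩: the largest class whose simple permutations are
-- exactly those of D, i.e. the permutations all of whose simple
-- subpermutations lie in D.
SubstClosure : (Perm → Set) → Perm → Set
SubstClosure D σ = ∀ τ → IsSimple τ → τ ≼ σ → D τ

Deflatable : (Perm → Set) → Set₁
Deflatable C = Σ (Perm → Set) λ D →
    IsClass D
  × (∀ σ → D σ → C σ)
  × (Σ Perm λ σ → C σ × ¬ D σ)
  × (∀ σ → C σ → SubstClosure D σ)

private
  map-inj : ∀ {m n} {f : Fin m → Fin m} {g : Fin n → Fin n} →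
            Injective _≡_ _≡_ f → Injective _≡_ _≡_ g →
            Injective _≡_ _≡_ (Sum.map f g)
  map-inj fi gi {inj₁ x} {inj₁ y} eq = cong inj₁ (fi (lem eq))
    where lem : ∀ {a b : Fin _} → _≡_ {A = Fin _ ⊎ Fin _} (inj₁ a) (inj₁ b) → a ≡ b
          lem refl = refl
  map-inj fi gi {inj₁ x} {inj₂ y} ()
  map-inj fi gi {inj₂ x} {inj₁ y} ()
  map-inj fi gi {inj₂ x} {inj₂ y} eq = cong inj₂ (gi (lem eq))
    where lem : ∀ {a b : Fin _} → _≡_ {A = Fin _ ⊎ Fin _} (inj₂ a) (inj₂ b) → a ≡ b
          lem refl = refl

_⊕_ : Perm → Perm → Perm
α ⊕ β = perm (len α Data.Nat.+ len β) f f-inj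
  where
    m = len α
    n = len β
    f : Fin (m Data.Nat.+ n) → Fin (m Data.Nat.+ n)
    f i = join m n (Sum.map (fun α) (fun β) (splitAt m i))
    f-inj : Injective _≡_ _≡_ f
    f-inj {i} {j} eq =
      trans (sym (join-splitAt m n i))
        (trans (cong (join m n)
                 (map-inj (inj α) (inj β)
                   {splitAt m i} {splitAt m j}
                   (trans (sym (splitAt-join m n (Sum.map (fun α) (fun β) (splitAt m i))))
                     (trans (cong (splitAt m) eq)
                       (splitAt-join m n (Sum.map (fun α) (fun β) (splitAt m j)))))))
               (join-splitAt m n j))

{-# OPTIONS --safe #-}
module Submission where

-- It suffices to embed every σ avoiding π = λ ⊕ ρ in a simple permutation
-- avoiding π, and since the goal is a negation this may be done classically.
--
-- The key step takes a proper interval J of at least two points and adds one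
-- point that cuts J and whose span with J contains a point outside J.  If for
-- some decomposition π = κ ⊕ μ the points south-west of J contain κ, then a
-- point put in a column through J, just below the lowest possible top p of
-- such a copy of κ, works: in any copy of π using it, the κ below and including
-- p could replace the lower part.  The same holds in the north-east.  Otherwise
-- let c be the lowest point above J (if there is none, rotate).  If neither the
-- point just above c and just right of the leftmost point of J, nor its mirror
-- image near the rightmost point d left of J works, then the points south-west
-- of J together with c contain λ, the points north-east of J together with d
-- contain ρ, and these two copies form a copy of π.
--
-- Iterating, every interval containing two given points of σ becomes the whole
-- configuration.  Added points are then deleted from any remaining proper
-- interval; this needs σ to have three points, so σ is first padded to
-- 1 ⊖ 1 ⊖ 1 ⊖ σ.

open import Defs
open import Data.Nat using (_≤_)
open import Relation.Nullary using (¬_)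

open import Data.Bool using (true)
open import Data.Empty using (⊥; ⊥-elim)
open import Data.Fin
  using (Fin; zero; suc; punchIn; punchOut; splitAt; _↑ˡ_; _↑ʳ_; fromℕ; fromℕ<; toℕ)
import Data.Fin as F
open import Data.Fin.Induction using (spo-wellFounded)
open import Data.Fin.Properties
  using (suc-injective; sequence; any?; ¬∀⟶∃¬;
         punchIn-punchOut; punchInᵢ≢i; punchIn-injective; toℕ-fromℕ<)
import Data.Fin.Properties as Finₚ
open import Data.Fin.Subset using (Subset; ∣_∣; _∈_; _∉_)
import Data.Fin.Subset.Properties as Subsetₚ
open import Data.List using (List; []; _∷_; allFin; cartesianProduct)
open import Data.List.Membership.Propositional.Properties using (∈-allFin; ∈-cartesianProduct⁺)
open import Data.List.Relation.Unary.All using (All; []; _∷_)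
import Data.List.Relation.Unary.All as All
open import Data.Nat using (ℕ; zero; suc; _<_; _∸_; z≤n; s≤s; s≤s⁻¹)
import Data.Nat.Properties as ℕ
open import Data.Product using (Σ; ∃; _×_; _,_; proj₁; proj₂)
open import Data.Sum using (_⊎_; inj₁; inj₂; [_,_]′)
open import Data.Unit using (⊤; tt)
import Data.Vec as Vec
import Data.Vec.Properties as Vecₚ
open import Effect.Monad using (RawMonad)
open import Function using (_∘_; flip; id)
open import Function.Definitions using (Injective)
open import Induction.WellFounded using (Acc; acc)
open import Relation.Binary using (IsStrictTotalOrder; Tri; tri<; tri≈; tri>)
import Relation.Binary.Construct.Flip.EqAndOrd as Flip
open import Relation.Binary.PropositionalEquality
  using (_≡_; _≢_; refl; sym; trans; cong; subst; subst₂; isEquivalence)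
open import Relation.Nullary using (Dec; yes; no; ¬?; does; DoubleNegation)
open import Relation.Nullary.Decidable using (¬¬-excluded-middle; decidable-stable; _×-dec_; dec-true)
open import Relation.Nullary.Negation using (¬¬-Monad)

-- Classical reasoning on finite sets

¬¬-all : ∀ {n} {P : Fin n → Set} → (∀ i → DoubleNegation (P i)) → DoubleNegation (∀ i → P i)
¬¬-all = sequence (RawMonad.rawApplicative ¬¬-Monad)

-- Double negation commutes with finite products, so while proving a negation any predicate on
-- `Fin n` may be taken to be decidable.
decide : ∀ {n} (P : Fin n → Set) → DoubleNegation (∀ i → Dec (P i))
decide P = ¬¬-all λ _ → ¬¬-excluded-middle

-- Planar configurations and their symmetries

data Axis : Set where
  X Y : Axis

other : Axis → Axis
other X = Y
other Y = X

-- A configuration of points in general position: only the left-to-right (X)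
-- and bottom-to-top (Y) orders of the points are recorded.
record Conf (A : Set) : Set₁ where
  field
    lt  : Axis → A → A → Set
    sto : ∀ ax → IsStrictTotalOrder _≡_ (lt ax)

  module _ {ax : Axis} where
    open IsStrictTotalOrder (sto ax) public
      using (compare; _≟_; _<?_; asym) renaming (trans to <-trans; irrefl to <-irrefl)

  ≮⇒≥ : ∀ {ax a b} → ¬ lt ax a b → b ≡ a ⊎ lt ax b a
  ≮⇒≥ {ax} {a} {b} a≮b with compare {ax} a b
  ... | tri< a<b _ _ = ⊥-elim (a≮b a<b)
  ... | tri≈ _ a≡b _ = inj₁ (sym a≡b)
  ... | tri> _ _ b<a = inj₂ b<a

  <-≮-trans : ∀ {ax a b c} → lt ax a b → ¬ lt ax c b → lt ax a c
  <-≮-trans {ax} {a} {b} {c} a<b c≮b with ≮⇒≥ c≮b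
  ... | inj₁ refl = a<b
  ... | inj₂ b<c  = <-trans a<b b<c

  ≮-<-trans : ∀ {ax a b c} → ¬ lt ax b a → lt ax b c → lt ax a c
  ≮-<-trans {ax} {a} {b} {c} b≮a b<c with ≮⇒≥ b≮a
  ... | inj₁ refl = b<c
  ... | inj₂ a<b  = <-trans a<b b<c
open Conf

-- The half-turn and the reflection in the main diagonal. Both preserve direct sums, the half-turn
-- exchanging the summands, so each later argument is carried out in one direction only.
rotate transpose : ∀ {A} → Conf A → Conf A
rotate τ = record { lt = λ ax → flip (lt τ ax) ; sto = λ ax → Flip.isStrictTotalOrder (sto τ ax) }
transpose τ = record { lt = λ ax → lt τ (other ax) ; sto = λ ax → sto τ (other ax) }

-- Descent along a well-founded order. As `P` need not be decidable, the existence of a smaller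
-- witness is settled under double negation.
least : ∀ {n} (τ : Conf (Fin n)) ax (P : Fin n → Set) {i} → P i →
        DoubleNegation (∃ λ (m : Fin n) → P m × (∀ {j} → P j → ¬ lt τ ax j m))
least {n} τ ax P {i} Pi = go Pi (spo-wellFounded (IsStrictTotalOrder.isStrictPartialOrder (sto τ ax)) i)
  where
  go : ∀ {i} → P i → Acc (lt τ ax) i →
       DoubleNegation (∃ λ (m : Fin n) → P m × (∀ {j} → P j → ¬ lt τ ax j m))
  go {i} Pi (acc rs) k = ¬¬-excluded-middle {A = ∃ λ j → P j × lt τ ax j i} λ where
    (yes (j , Pj , j<i)) → go Pj (rs j<i) k
    (no ∄)               → k (i , Pi , λ {j} Pj j<i → ∄ (j , Pj , j<i))

-- Copies, direct sum decompositions and intervals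

CopyOn : ∀ {A B} (S : A → Set) → Conf A → Conf B → (A → B) → Set
CopyOn S π τ e = ∀ ax {i j} → S i → S j → lt π ax i j → lt τ ax (e i) (e j)

Copy : ∀ {A B} → Conf A → Conf B → (A → B) → Set
Copy π τ e = ∀ ax {i j} → lt π ax i j → lt τ ax (e i) (e j)

Avoids : ∀ {A B} → Conf A → Conf B → Set
Avoids π τ = ∀ e → ¬ Copy π τ e

module _ {A B} {π : Conf A} {τ : Conf B} {e : A → B} (copy : Copy π τ e) where

  copy-reflects : ∀ {ax i j} → lt τ ax (e i) (e j) → lt π ax i j
  copy-reflects {ax} {i} {j} ei<ej with compare π {ax} i j
  ... | tri< i<j _ _  = i<j
  ... | tri≈ _ refl _ = ⊥-elim (<-irrefl τ refl ei<ej)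
  ... | tri> _ _ j<i  = ⊥-elim (asym τ ei<ej (copy ax j<i))

  copy-injective : ∀ {i j} → e i ≡ e j → i ≡ j
  copy-injective {i} {j} eq with compare π {X} i j
  ... | tri< i<j _ _ = ⊥-elim (<-irrefl τ eq (copy X i<j))
  ... | tri≈ _ i≡j _ = i≡j
  ... | tri> _ _ j<i = ⊥-elim (<-irrefl τ (sym eq) (copy X j<i))

-- A decomposition of π as a direct sum.
record Cut {A} (π : Conf A) : Set₁ where
  field
    Lo Hi : A → Set
    side  : ∀ i → Lo i ⊎ Hi i
    lo<hi : ∀ ax {i j} → Lo i → Hi j → lt π ax i j
open Cut

module _ {A B} {π : Conf A} (τ : Conf B) (avoids : Avoids π τ) (κ : Cut π) where

  -- Relations inside a part come from the copy of that part, relations across from the last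
  -- hypothesis; so halves of two different copies can be combined.
  no-glue : ∀ (e e′ : A → B) → CopyOn (Lo κ) π τ e → CopyOn (Hi κ) π τ e′ →
            (∀ ax {i j} → Lo κ i → Hi κ j → lt τ ax (e i) (e′ j)) → ⊥
  no-glue e e′ copyLo copyHi cross = avoids glued glued-copy
    where
    glued : A → B
    glued i = [ (λ _ → e i) , (λ _ → e′ i) ]′ (side κ i)
    glued-copy : Copy π τ glued
    glued-copy ax {i} {j} i<j with side κ i | side κ j
    ... | inj₁ Li | inj₁ Lj = copyLo ax Li Lj i<j
    ... | inj₁ Li | inj₂ Hj = cross ax Li Hj
    ... | inj₂ Hi | inj₁ Lj = ⊥-elim (asym π i<j (lo<hi κ ax Lj Hi))
    ... | inj₂ Hi | inj₂ Hj = copyHi ax Hi Hj i<j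

rotateCut : ∀ {A} {π : Conf A} → Cut π → Cut (rotate π)
rotateCut κ = record
  { Lo = Hi κ ; Hi = Lo κ
  ; side = λ i → [ inj₂ , inj₁ ]′ (side κ i)
  ; lo<hi = λ ax Hi Lj → lo<hi κ ax Lj Hi }

transposeCut : ∀ {A} {π : Conf A} → Cut π → Cut (transpose π)
transposeCut κ = record
  { Lo = Lo κ ; Hi = Hi κ ; side = side κ ; lo<hi = λ ax → lo<hi κ (other ax) }

-- Convexity in both orders amounts to consecutive positions and values. The empty set and the whole
-- configuration are allowed.
Interval : ∀ {A} → Conf A → (A → Set) → Set
Interval τ J = ∀ ax {a b z} → J a → J b → lt τ ax a z → lt τ ax z b → J z

module _ {A} (τ : Conf A) {J : A → Set} (interval : Interval τ J) where

  -- A point with points of `J` on both sides would belong to `J`.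
  above-all : ∀ {ax i j} → ¬ J i → J j → lt τ ax j i → ∀ {j′} → J j′ → lt τ ax j′ i
  above-all {ax} {i} {j} i∉J Jj j<i {j′} Jj′ with compare τ {ax} j′ i
  ... | tri< j′<i _ _ = j′<i
  ... | tri≈ _ refl _ = ⊥-elim (i∉J Jj′)
  ... | tri> _ _ i<j′ = ⊥-elim (i∉J (interval ax Jj Jj′ j<i i<j′))

  below-all : ∀ {ax i j} → ¬ J i → J j → lt τ ax i j → ∀ {j′} → J j′ → lt τ ax i j′
  below-all {ax} {i} {j} i∉J Jj i<j {j′} Jj′ with compare τ {ax} i j′
  ... | tri< i<j′ _ _ = i<j′
  ... | tri≈ _ refl _ = ⊥-elim (i∉J Jj′)
  ... | tri> _ _ j′<i = ⊥-elim (i∉J (interval ax Jj′ Jj j′<i i<j))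

rotateInterval : ∀ {A} {τ : Conf A} {J} → Interval τ J → Interval (rotate τ) J
rotateInterval interval ax Ja Jb z<a b<z = interval ax Jb Ja b<z z<a

transposeInterval : ∀ {A} {τ : Conf A} {J} → Interval τ J → Interval (transpose τ) J
transposeInterval interval ax = interval (other ax)

-- Insertion of a point

module _ {n} (τ : Conf (Fin n)) where

  -- A gap in each order, given by the initial segment in front of it. Decidability of the segment
  -- yields trichotomy for the new point.
  record Place : Set₁ where
    field
      Before : Axis → Fin n → Set
      before? : ∀ ax i → Dec (Before ax i)
      closed : ∀ ax {i j} → lt τ ax i j → Before ax j → Before ax i

  private
    ins : (Fin n → Fin n → Set) → (Fin n → Set) → Fin (suc n) → Fin (suc n) → Set
    ins _<_ B zero    zero    = ⊥
    ins _<_ B zero    (suc j) = ¬ B j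
    ins _<_ B (suc i) zero    = B i
    ins _<_ B (suc i) (suc j) = i < j

  -- The inserted point is zero; the old points are the successors.
  insert : Place → Conf (Fin (suc n))
  insert pl = record
    { lt  = λ ax → ins (lt τ ax) (Before ax)
    ; sto = λ ax → record
      { isStrictPartialOrder = record
        { isEquivalence = isEquivalence
        ; irrefl = λ { {zero} refl () ; {suc i} refl i<i → <-irrefl τ refl i<i }
        ; trans = λ {i} {j} {k} → tr ax i j k
        ; <-resp-≈ = (λ { refl p → p }) , (λ { refl p → p })
        }
      ; compare = cmp ax
      }
    }
    where
    open Place pl
    tr : ∀ ax i j k → let _<_ = ins (lt τ ax) (Before ax) in i < j → j < k → i < k
    tr ax zero    (suc j) zero    ¬Bj Bj  = ¬Bj Bj
    tr ax zero    (suc j) (suc k) ¬Bj j<k = λ Bk → ¬Bj (closed ax j<k Bk)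
    tr ax (suc i) zero    (suc k) Bi ¬Bk with compare τ {ax} i k
    ... | tri< i<k _ _  = i<k
    ... | tri≈ _ refl _ = ⊥-elim (¬Bk Bi)
    ... | tri> _ _ k<i  = ⊥-elim (¬Bk (closed ax k<i Bi))
    tr ax (suc i) (suc j) zero    i<j Bj  = closed ax i<j Bj
    tr ax (suc i) (suc j) (suc k) i<j j<k = <-trans τ i<j j<k
    cmp : ∀ ax i j → let _<_ = ins (lt τ ax) (Before ax) in Tri (i < j) (i ≡ j) (j < i)
    cmp ax zero    zero    = tri≈ (λ ()) refl (λ ())
    cmp ax zero    (suc j) with before? ax j
    ... | yes Bj = tri> (λ ¬Bj → ¬Bj Bj) (λ ()) Bj
    ... | no ¬Bj = tri< ¬Bj (λ ()) ¬Bj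
    cmp ax (suc i) zero    with before? ax i
    ... | yes Bi = tri< Bi (λ ()) (λ ¬Bi → ¬Bi Bi)
    ... | no ¬Bi = tri> ¬Bi (λ ()) ¬Bi
    cmp ax (suc i) (suc j) with compare τ {ax} i j
    ... | tri< p q r = tri< p (q ∘ suc-injective) r
    ... | tri≈ p q r = tri≈ p (cong suc q) r
    ... | tri> p q r = tri> p (q ∘ suc-injective) r

-- Since every interval of the grown configuration that contains J also
-- contains the new point and z, it misses fewer points than J did.
record Growth {A n} (π : Conf A) (τ : Conf (Fin n)) (J : Fin n → Set) : Set₁ where
  field
    grown  : Conf (Fin (suc n))
    old    : Copy τ grown suc
    avoids : Avoids π grown
    cuts   : ∃ λ ax → ∃ λ j → ∃ λ j′ → J j × J j′ ×
             lt grown ax (suc j) zero × lt grown ax zero (suc j′)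
    gains  : ∃ λ ax → ∃ λ z → ∃ λ j → ¬ J z × J j ×
             ((lt grown ax (suc j) (suc z) × lt grown ax (suc z) zero) ⊎
              (lt grown ax zero (suc z) × lt grown ax (suc z) (suc j)))

rotateGrowth : ∀ {A n} {π : Conf A} {τ : Conf (Fin n)} {J} →
               Growth (rotate π) (rotate τ) J → Growth π τ J
rotateGrowth g = record
  { grown  = rotate grown
  ; old    = λ ax → old ax
  ; avoids = λ e copy → avoids e (λ ax → copy ax)
  ; cuts   = let (ax , j , j′ , Jj , Jj′ , p , q) = cuts in ax , j′ , j , Jj′ , Jj , q , p
  ; gains  = let (ax , z , j , z∉J , Jj , btw) = gains in
             ax , z , j , z∉J , Jj ,
             [ (λ { (p , q) → inj₂ (q , p) }) , (λ { (p , q) → inj₁ (q , p) }) ]′ btw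
  }
  where open Growth g

transposeGrowth : ∀ {A n} {π : Conf A} {τ : Conf (Fin n)} {J} →
                  Growth (transpose π) (transpose τ) J → Growth π τ J
transposeGrowth {π = π} {τ} g = record
  { grown  = transpose grown
  ; old    = λ { X → old Y ; Y → old X }
  ; avoids = λ e copy → avoids e (λ { X → copy Y ; Y → copy X })
  ; cuts   = turn cuts
  ; gains  = turn gains
  }
  where
  open Growth g
  turn : ∀ {P : Axis → Set} → ∃ P → ∃ (P ∘ other)
  turn (X , p) = Y , p
  turn (Y , p) = X , p

-- Copies that use the inserted point

-- `d` is a default value for the new point; the facts about `drop d` concern only points not sent
-- to `zero`.
drop : ∀ {n} → Fin n → Fin (suc n) → Fin n
drop d zero    = d
drop d (suc i) = i

suc-drop : ∀ {n} (d : Fin n) {k : Fin (suc n)} → k ≢ zero → suc (drop d k) ≡ k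
suc-drop d {zero}  k≢0 = ⊥-elim (k≢0 refl)
suc-drop d {suc k} _   = refl

module _ {A n} (π : Conf A) {τ : Conf (Fin n)} (pl : Place τ) (d : Fin n) where
  open Place pl

  drop-copyOn : ∀ (S : A → Set) e → (∀ i → S i → e i ≢ zero) →
                Copy π (insert τ pl) e → CopyOn S π τ (drop d ∘ e)
  drop-copyOn S e S≢0 copy ax {i} {j} Si Sj i<j
    with e i | e j | S≢0 i Si | S≢0 j Sj | copy ax i<j
  ... | zero  | _     | ei≢0 | _    | _ = ⊥-elim (ei≢0 refl)
  ... | suc _ | zero  | _    | ej≢0 | _ = ⊥-elim (ej≢0 refl)
  ... | suc _ | suc _ | _    | _    | ei<ej = ei<ej

  insert-avoids : Avoids π τ → (∀ {e} → Copy π (insert τ pl) e → ∀ a → e a ≢ zero) →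
                  Avoids π (insert τ pl)
  insert-avoids avoids unused e copy = avoids (drop d ∘ e)
    λ ax → drop-copyOn (λ _ → ⊤) e (λ i _ → unused {e} copy i) copy ax tt tt

  module Used (e : A → Fin (suc n)) (copy : Copy π (insert τ pl) e) {a : A} (ea≡0 : e a ≡ zero) where

    ≢⇒old : ∀ {i} → i ≢ a → e i ≢ zero
    ≢⇒old i≢a ei≡0 = i≢a (copy-injective {π = π} {insert τ pl} copy (trans ei≡0 (sym ea≡0)))

    <⇒old : ∀ {ax i} → lt π ax i a → e i ≢ zero
    <⇒old i<a = ≢⇒old λ i≡a → <-irrefl π i≡a i<a

    >⇒old : ∀ {ax i} → lt π ax a i → e i ≢ zero
    >⇒old a<i = ≢⇒old λ i≡a → <-irrefl π (sym i≡a) a<i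

    <⇒before : ∀ {ax i} → lt π ax i a → Before ax (drop d (e i))
    <⇒before {ax} {i} i<a with e i | <⇒old i<a | copy ax i<a
    ... | zero  | ei≢0 | _ = ⊥-elim (ei≢0 refl)
    ... | suc _ | _    | ei<ea rewrite ea≡0 = ei<ea

    >⇒after : ∀ {ax i} → lt π ax a i → ¬ Before ax (drop d (e i))
    >⇒after {ax} {i} a<i with e i | >⇒old a<i | copy ax a<i
    ... | zero  | ei≢0 | _ = ⊥-elim (ei≢0 refl)
    ... | suc _ | _    | ea<ei rewrite ea≡0 = ea<ei

    after⇒> : ∀ {ax i} → i ≢ a → ¬ Before ax (drop d (e i)) → lt π ax a i
    after⇒> {ax} {i} i≢a ¬B with compare π {ax} a i
    ... | tri< a<i _ _ = a<i
    ... | tri≈ _ a≡i _ = ⊥-elim (i≢a (sym a≡i))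
    ... | tri> _ _ i<a = ⊥-elim (¬B (<⇒before i<a))

-- Growth from a copy of one part beside an interval

SouthWest NorthEast : ∀ {A} → Conf A → (A → Set) → A → Set
SouthWest τ J i = ∀ ax {j} → J j → lt τ ax i j
NorthEast τ J i = ∀ ax {j} → J j → lt τ ax j i

-- The inserted point goes just below p, where p is the lowest possible
-- topmost point of a copy of the lower part to the south-west of J.  A copy
-- of π using it in its lower part could be rerouted through p.
southwest-growth : ∀ {A n} {π : Conf A} {τ : Conf (Fin n)} {J} →
  Avoids π τ → Interval τ J → ∀ {j₁ j₂} → J j₁ → J j₂ → lt τ X j₁ j₂ →
  (κ : Cut π) → ∃ (Lo κ) → ∀ e → CopyOn (Lo κ) π τ e →
  (∀ s → Lo κ s → SouthWest τ J (e s)) → DoubleNegation (Growth π τ J)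
southwest-growth {A} {n} {π} {τ} {J} avoids interval {j₁} {j₂} Jj₁ Jj₂ j₁<j₂ κ (s₀ , Ls₀)
                 e₀ copy₀ sw₀ no-growth =
  -- `e₀` shows that `Top` is inhabited, so `Top` has a lowest element.
  highest e₀ λ (s , Ls , max) →
  least τ Y Top (e₀ , copy₀ , sw₀ , (s , Ls , refl) , max) impossible
  where
  Top : Fin n → Set
  Top p = ∃ λ e → CopyOn (Lo κ) π τ e × (∀ s → Lo κ s → SouthWest τ J (e s)) ×
          (∃ λ s → Lo κ s × e s ≡ p) × (∀ s → Lo κ s → ¬ lt τ Y p (e s))

  highest : (e : A → Fin n) → DoubleNegation (∃ λ s → Lo κ s × (∀ t → Lo κ t → ¬ lt τ Y (e s) (e t)))
  highest e k =
    least (rotate τ) Y (λ i → ∃ λ s → Lo κ s × e s ≡ i) (s₀ , Ls₀ , refl)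
      λ { (_ , (s , Ls , refl) , max) → k (s , Ls , λ t Lt → max (t , Lt , refl)) }

  impossible : ¬ (∃ λ p → Top p × (∀ {q} → Top q → ¬ lt τ Y q p))
  impossible (p , (e , copy , sw , (sₚ , Lsₚ , refl) , max) , lowest) =
    no-growth record
      { grown = insert τ pl ; old = λ _ → id
      ; avoids = insert-avoids π pl j₁ avoids (λ {g} → unused {g})
      ; cuts = X , j₁ , j₂ , Jj₁ , Jj₂ , <-irrefl τ refl , λ ¬j₁<j₂ → ¬j₁<j₂ j₁<j₂
      ; gains = Y , p , j₁ , p∉J , Jj₁ , inj₂ (<-irrefl τ refl , sw sₚ Lsₚ Y Jj₁)
      }
    where
    p∉J : ¬ J p
    p∉J Jp = <-irrefl τ refl (sw sₚ Lsₚ Y Jp)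

    pl : Place τ
    pl = record
      -- The new point is immediately right of `j₁`, with `j₂` on its other side, and immediately
      -- below `p`.
      { Before = λ { X i → ¬ lt τ X j₁ i ; Y i → lt τ Y i p }
      ; before? = λ { X i → ¬? (_<?_ τ j₁ i) ; Y i → _<?_ τ i p }
      ; closed = λ { X i<j ¬j₁<j j₁<i → ¬j₁<j (<-trans τ j₁<i i<j) ; Y → <-trans τ }
      }

    unused : ∀ {g} → Copy π (insert τ pl) g → ∀ a → g a ≢ zero
    unused {g} copy′ a ga≡0 with side κ a
    -- Here the whole lower part precedes the new point: it is below `p`, so it misses `J` and lies
    -- to the left of `J`, and its top contradicts the choice of `p`.
    ... | inj₂ Ha = highest h λ (s , Ls , max′) →
                    lowest (h , drop-copyOn π pl j₁ (Lo κ) g lo-old copy′ , sw′ ,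
                            (s , Ls , refl) , max′)
                           (before Y Ls)
      where
      open Used π pl j₁ g copy′ ga≡0
      h : A → Fin n
      h = drop j₁ ∘ g
      lo-old : ∀ s → Lo κ s → g s ≢ zero
      lo-old s Ls = <⇒old (lo<hi κ X Ls Ha)
      before : ∀ ax {s} → Lo κ s → Place.Before pl ax (h s)
      before ax Ls = <⇒before (lo<hi κ ax Ls Ha)
      hs∉J : ∀ {s} → Lo κ s → ¬ J (h s)
      hs∉J Ls Jhs = asym τ (before Y Ls) (sw sₚ Lsₚ Y Jhs)
      sw′ : ∀ s → Lo κ s → SouthWest τ J (h s)
      sw′ s Ls Y Jj = <-trans τ (before Y Ls) (sw sₚ Lsₚ Y Jj)
      sw′ s Ls X with ≮⇒≥ τ (before X Ls)
      ... | inj₁ hs≡j₁ = ⊥-elim (hs∉J Ls (subst J (sym hs≡j₁) Jj₁))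
      ... | inj₂ hs<j₁ = below-all τ interval (hs∉J Ls) Jj₁ hs<j₁
    -- Here the upper part lies right of `j₁`, so it does not contain `p`, and it lies above `p`;
    -- hence `e` can replace the lower part of the copy.
    ... | inj₁ La = no-glue τ avoids κ e h copy (drop-copyOn π pl j₁ (Hi κ) g hi-old copy′) cross
      where
      open Used π pl j₁ g copy′ ga≡0
      h : A → Fin n
      h = drop j₁ ∘ g
      hi-old : ∀ b → Hi κ b → g b ≢ zero
      hi-old b Hb = >⇒old (lo<hi κ X La Hb)
      after : ∀ ax {b} → Hi κ b → ¬ Place.Before pl ax (h b)
      after ax Hb = >⇒after (lo<hi κ ax La Hb)
      j₁<h : ∀ {b} → Hi κ b → lt τ X j₁ (h b)
      j₁<h {b} Hb = decidable-stable (_<?_ τ j₁ (h b)) (after X Hb)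
      cross : ∀ ax {i j} → Lo κ i → Hi κ j → lt τ ax (e i) (h j)
      cross X Li Hj = <-trans τ (sw _ Li X Jj₁) (j₁<h Hj)
      cross Y {i} {j} Li Hj with ≮⇒≥ τ (after Y Hj)
      ... | inj₁ p≡hj = ⊥-elim (<-irrefl τ p≡hj (<-trans τ (sw sₚ Lsₚ X Jj₁) (j₁<h Hj)))
      ... | inj₂ p<hj = ≮-<-trans τ (max i Li) p<hj

-- Pairs of points and the corner lemma

Two : ∀ {A : Set} → (A → Set) → Set
Two P = ∃ λ i → ∃ λ j → P i × P j × i ≢ j

two-others : ∀ {A} (π : Conf A) {P : A → Set} → Two P → ∀ a → ∃ λ i → P i × i ≢ a
two-others π (i , j , Pi , Pj , i≢j) a with _≟_ π {X} i a
... | yes i≡a = j , Pj , λ j≡a → i≢j (trans i≡a (sym j≡a))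
... | no  i≢a = i , Pi , i≢a

two-ordered : ∀ {A} (τ : Conf A) {P : A → Set} → Two P →
              ∃ λ i → ∃ λ j → P i × P j × lt τ X i j
two-ordered τ (i , j , Pi , Pj , i≢j) with compare τ {X} i j
... | tri< i<j _ _ = i , j , Pi , Pj , i<j
... | tri≈ _ i≡j _ = ⊥-elim (i≢j i≡j)
... | tri> _ _ j<i = j , i , Pj , Pi , j<i

module Stuck {A n} {π : Conf A} {τ : Conf (Fin n)} {J : Fin n → Set}
             (avoids : Avoids π τ) (interval : Interval τ J)
             (J-two : Two J) (stuck : ¬ Growth π τ J) where

  private
    J-pair : ∃ λ j₁ → ∃ λ j₂ → J j₁ × J j₂ × lt τ X j₁ j₂
    J-pair = two-ordered τ J-two

  -- Stated for every decomposition of `π`, because `corner` also applies it after moving one point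
  -- across the cut.
  no-southwest : (κ : Cut π) → ∃ (Lo κ) → ∀ e → CopyOn (Lo κ) π τ e →
                 ¬ (∀ s → Lo κ s → SouthWest τ J (e s))
  no-southwest κ ∃Lo e copy sw =
    let (_ , _ , Jj₁ , Jj₂ , j₁<j₂) = J-pair in
    southwest-growth avoids interval Jj₁ Jj₂ j₁<j₂ κ ∃Lo e copy sw stuck

  no-northeast : (κ : Cut π) → ∃ (Hi κ) → ∀ e → CopyOn (Hi κ) π τ e →
                 ¬ (∀ s → Hi κ s → NorthEast τ J (e s))
  no-northeast κ ∃Hi e copy ne =
    let (_ , _ , Jj₁ , Jj₂ , j₁<j₂) = J-pair in
    southwest-growth {π = rotate π} {rotate τ} (λ e copy → avoids e (λ ax → copy ax))
      (rotateInterval {τ = τ} interval) Jj₂ Jj₁ j₁<j₂ (rotateCut κ) ∃Hi e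
      (λ ax Hi Hj → copy ax Hj Hi) ne (stuck ∘ rotateGrowth)

  -- Inserting a point just right of the leftmost point f of J and just above
  -- the lowest point c above J must create a copy of π, of a very special form.
  corner : (κ : Cut π) → Two (Lo κ) → Two (Hi κ) →
           ∀ c → (∀ {j} → J j → lt τ Y j c) →
           (∀ {i} → (∀ {j} → J j → lt τ Y j i) → ¬ lt τ Y i c) →
           DoubleNegation (∃ λ e → CopyOn (Lo κ) π τ e ×
                           (∀ s → Lo κ s → SouthWest τ J (e s) ⊎ e s ≡ c) ×
                           (∀ {j} → J j → lt τ X c j) ×
                           ∃ λ y → lt τ X c y × (∀ {j} → J j → lt τ X y j))
  corner κ Lo-two Hi-two c above lowest k =
    least τ X J (proj₁ (proj₂ (proj₂ J-two))) from-leftmost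
    where
    c∉J : ¬ J c
    c∉J Jc = <-irrefl τ refl (above Jc)

    from-leftmost : ¬ (∃ λ f → J f × (∀ {j} → J j → ¬ lt τ X j f))
    from-leftmost (f , Jf , leftmost) = stuck record
      { grown = insert τ pl ; old = λ _ → id
      ; avoids = insert-avoids π pl f avoids (λ {g} → unused {g})
      ; cuts = X , f , proj₁ right , Jf , proj₁ (proj₂ right) , <-irrefl τ refl ,
               λ ¬f<r → ¬f<r (proj₂ (proj₂ right))
      ; gains = Y , c , f , c∉J , Jf , inj₁ (above Jf , <-irrefl τ refl)
      }
      where
      right : ∃ λ j → J j × lt τ X f j
      right = let (j₁ , j₂ , Jj₁ , Jj₂ , j₁<j₂) = J-pair in
              j₂ , Jj₂ , ≮-<-trans τ (leftmost Jj₁) j₁<j₂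

      pl : Place τ
      pl = record
        -- The weak inequalities put the new point immediately right of `f` and immediately above
        -- `c`.
        { Before = λ { X i → ¬ lt τ X f i ; Y i → ¬ lt τ Y c i }
        ; before? = λ { X i → ¬? (_<?_ τ f i) ; Y i → ¬? (_<?_ τ c i) }
        ; closed = λ { X i<j f≮j f<i → f≮j (<-trans τ f<i i<j)
                     ; Y i<j c≮j c<i → c≮j (<-trans τ c<i i<j) }
        }
      open Place pl

      after-X : ∀ {i} → ¬ Before X i → lt τ X f i
      after-X {i} = decidable-stable (_<?_ τ f i)
      after-Y : ∀ {i} → ¬ Before Y i → lt τ Y c i
      after-Y {i} = decidable-stable (_<?_ τ c i)

      above∉J : ∀ {i} → lt τ Y c i → ¬ J i
      above∉J c<i Ji = asym τ c<i (above Ji)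

      northeast : ∀ {i} → lt τ X f i → lt τ Y c i → NorthEast τ J i
      northeast f<i c<i X Jj = above-all τ interval (above∉J c<i) Jf f<i Jj
      northeast f<i c<i Y Jj = <-trans τ (above Jj) c<i

      left : ∀ {i} → ¬ J i → ¬ lt τ X f i → ∀ {j} → J j → lt τ X i j
      left i∉J f≮i with ≮⇒≥ τ f≮i
      ... | inj₁ refl = ⊥-elim (i∉J Jf)
      ... | inj₂ i<f  = below-all τ interval i∉J Jf i<f

      -- A point left of `f` is outside `J`, so it lies above or below all of `J`; a point above `J`
      -- and below `c` is excluded by the choice of `c`.
      classify : ∀ {i} → Before X i → Before Y i → i ≡ f ⊎ i ≡ c ⊎ SouthWest τ J i
      classify {i} f≮i c≮i with ≮⇒≥ τ f≮i | ≮⇒≥ τ c≮i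
      ... | inj₁ i≡f | _ = inj₁ i≡f
      ... | inj₂ _   | inj₁ i≡c = inj₂ (inj₁ i≡c)
      ... | inj₂ i<f | inj₂ i<c = inj₂ (inj₂ λ where
              X Jj → left i∉J f≮i Jj
              Y Jj → below-all τ interval i∉J Jf i<ᵧf Jj)
        where
        i∉J : ¬ J i
        i∉J Ji = leftmost Ji i<f
        i<ᵧf : lt τ Y i f
        i<ᵧf with compare τ {Y} i f
        ... | tri< i<f _ _  = i<f
        ... | tri≈ _ refl _ = ⊥-elim (i∉J Jf)
        ... | tri> _ _ f<i  = ⊥-elim (lowest (above-all τ interval i∉J Jf f<i) i<c)

      unused : ∀ {g} → Copy π (insert τ pl) g → ∀ a → g a ≢ zero
      unused {g} copy a ga≡0 with side κ a
      -- A new point in the lower part forces the upper part to the north-east of `J`.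
      ... | inj₁ La = no-northeast κ (let (b , _ , Hb , _) = Hi-two in b , Hb) h
                        (drop-copyOn π pl f (Hi κ) g (λ b Hb → >⇒old (lo<hi κ X La Hb)) copy)
                        (λ b Hb → northeast (after-X (>⇒after (lo<hi κ X La Hb)))
                                            (after-Y (>⇒after (lo<hi κ Y La Hb))))
        where
        open Used π pl f g copy ga≡0
        h : A → Fin n
        h = drop f ∘ g
      ... | inj₂ Ha =
        -- The lower part must use `c`, and the upper part must have a second point left of `J`. In
        -- every other case one part, possibly less a point, lies wholly south-west or north-east of
        -- `J`.
        ¬¬-excluded-middle {A = ∃ λ s → Lo κ s × h s ≡ c} λ where
          (no ∄c) → ¬¬-excluded-middle {A = ∃ λ s → Lo κ s × h s ≡ f} λ where
            (no ∄f)              → without-c-f ∄c ∄f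
            (yes (s , Ls , hs≡f)) → without-c ∄c Ls hs≡f
          (yes (s , Ls , hs≡c)) →
            ¬¬-excluded-middle {A = ∃ λ b → Hi κ b × b ≢ a × ¬ lt τ X f (h b)} λ where
              (no ∄b) → right-of-f Ls hs≡c λ b Hb b≢a f≮hb → ∄b (b , Hb , b≢a , f≮hb)
              (yes (b , Hb , b≢a , f≮hb)) → found Ls hs≡c Hb b≢a f≮hb
        where
        open Used π pl f g copy ga≡0
        h : A → Fin n
        h = drop f ∘ g
        before : ∀ ax {s} → Lo κ s → Before ax (h s)
        before ax Ls = <⇒before (lo<hi κ ax Ls Ha)
        where-lo : ∀ {s} → Lo κ s → h s ≡ f ⊎ h s ≡ c ⊎ SouthWest τ J (h s)
        where-lo Ls = classify (before X Ls) (before Y Ls)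
        lo-old : ∀ s → Lo κ s → g s ≢ zero
        lo-old s Ls = <⇒old (lo<hi κ X Ls Ha)
        lo-copy : CopyOn (Lo κ) π τ h
        lo-copy = drop-copyOn π pl f (Lo κ) g lo-old copy
        pair : A → A → A → Set
        pair i j k = k ≡ i ⊎ k ≡ j
        old-pair : ∀ {i j} → g i ≢ zero → g j ≢ zero → ∀ {ax} → lt π ax i j → lt τ ax (h i) (h j)
        old-pair {i} {j} gi≢0 gj≢0 {ax} =
          drop-copyOn π pl f (pair i j) g
            (λ { _ (inj₁ refl) → gi≢0 ; _ (inj₂ refl) → gj≢0 }) copy ax (inj₁ refl) (inj₂ refl)

        without-c-f : ¬ (∃ λ s → Lo κ s × h s ≡ c) → ¬ (∃ λ s → Lo κ s × h s ≡ f) → ⊥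
        without-c-f ∄c ∄f =
          no-southwest κ (let (s , _ , Ls , _) = Lo-two in s , Ls) h lo-copy sw
          where
          sw : ∀ s → Lo κ s → SouthWest τ J (h s)
          sw s Ls with where-lo Ls
          ... | inj₁ hs≡f        = ⊥-elim (∄f (s , Ls , hs≡f))
          ... | inj₂ (inj₁ hs≡c) = ⊥-elim (∄c (s , Ls , hs≡c))
          ... | inj₂ (inj₂ hs-sw) = hs-sw

        -- The point playing f is then the maximum of the lower part in both
        -- orders, so it can be moved to the upper part of the cut.
        without-c : ¬ (∃ λ s → Lo κ s × h s ≡ c) → ∀ {s} → Lo κ s → h s ≡ f → ⊥
        without-c ∄c {s₀} Ls₀ hs₀≡f =
          no-southwest κ′ (let (s , Ls , s≢s₀) = two-others π Lo-two s₀ in s , Ls , s≢s₀) h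
            (λ ax (Li , _) (Lj , _) → lo-copy ax Li Lj) (λ s (Ls , s≢s₀) → sw Ls s≢s₀)
          where
          sw : ∀ {s} → Lo κ s → s ≢ s₀ → SouthWest τ J (h s)
          sw {s} Ls s≢s₀ with where-lo Ls
          ... | inj₂ (inj₁ hs≡c)  = ⊥-elim (∄c (s , Ls , hs≡c))
          ... | inj₂ (inj₂ hs-sw) = hs-sw
          ... | inj₁ hs≡f with compare π {X} s s₀
          ...   | tri< s<s₀ _ _ = ⊥-elim (<-irrefl τ (trans hs≡f (sym hs₀≡f)) (lo-copy X Ls Ls₀ s<s₀))
          ...   | tri≈ _ s≡s₀ _ = ⊥-elim (s≢s₀ s≡s₀)
          ...   | tri> _ _ s₀<s = ⊥-elim (<-irrefl τ (trans hs₀≡f (sym hs≡f)) (lo-copy X Ls₀ Ls s₀<s))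
          κ′ : Cut π
          κ′ = record
            { Lo = λ i → Lo κ i × i ≢ s₀
            ; Hi = λ i → Hi κ i ⊎ i ≡ s₀
            ; side = side′
            ; lo<hi = λ where
                ax (Li , _) (inj₁ Hj) → lo<hi κ ax Li Hj
                ax (Li , i≢s₀) (inj₂ refl) → i<s₀ ax Li i≢s₀
            }
            where
            side′ : ∀ i → (Lo κ i × i ≢ s₀) ⊎ (Hi κ i ⊎ i ≡ s₀)
            side′ i with side κ i | _≟_ π {X} i s₀
            ... | inj₂ Hi | _        = inj₂ (inj₁ Hi)
            ... | inj₁ Li | yes i≡s₀ = inj₂ (inj₂ i≡s₀)
            ... | inj₁ Li | no  i≢s₀ = inj₁ (Li , i≢s₀)
            i<s₀ : ∀ ax {i} → Lo κ i → i ≢ s₀ → lt π ax i s₀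
            i<s₀ ax {i} Li i≢s₀ with compare π {ax} i s₀
            ... | tri< i<s₀ _ _ = i<s₀
            ... | tri≈ _ i≡s₀ _ = ⊥-elim (i≢s₀ i≡s₀)
            -- `s₀` plays `f`, while the point playing `i` is south-west of `J`, which contains `f`.
            ... | tri> _ _ s₀<i = ⊥-elim (asym τ (lo-copy ax Ls₀ Li s₀<i)
                                    (subst (lt τ ax (h i)) (sym hs₀≡f) (sw Li i≢s₀ ax Jf)))

        c<h : ∀ {s} → Lo κ s → h s ≡ c → ∀ {b} → Hi κ b → b ≢ a → ∀ ax → lt τ ax c (h b)
        c<h {s} Ls hs≡c {b} Hb b≢a ax = subst (λ i → lt τ ax i (h b)) hs≡c
          (old-pair (lo-old s Ls) (≢⇒old b≢a) (lo<hi κ ax Ls Hb))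

        -- Dually, a is the minimum of the upper part in both orders.
        right-of-f : ∀ {s} → Lo κ s → h s ≡ c → (∀ b → Hi κ b → b ≢ a → ¬ ¬ lt τ X f (h b)) → ⊥
        right-of-f Ls hs≡c f<h =
          no-northeast κ′ (let (b , Hb , b≢a) = two-others π Hi-two a in b , Hb , b≢a) h
            (drop-copyOn π pl f (λ i → Hi κ i × i ≢ a) g (λ b (_ , b≢a) → ≢⇒old b≢a) copy)
            (λ b (Hb , b≢a) → northeast (after-X (f<h b Hb b≢a)) (c<h Ls hs≡c Hb b≢a Y))
          where
          κ′ : Cut π
          κ′ = record
            { Lo = λ i → Lo κ i ⊎ i ≡ a
            ; Hi = λ i → Hi κ i × i ≢ a
            ; side = side′
            ; lo<hi = λ where
                ax (inj₁ Li) (Hj , _) → lo<hi κ ax Li Hj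
                X (inj₂ refl) (Hj , j≢a) → after⇒> j≢a (f<h _ Hj j≢a)
                Y (inj₂ refl) (Hj , j≢a) → after⇒> j≢a λ c≮hj → c≮hj (c<h Ls hs≡c Hj j≢a Y)
            }
            where
            side′ : ∀ i → (Lo κ i ⊎ i ≡ a) ⊎ (Hi κ i × i ≢ a)
            side′ i with side κ i | _≟_ π {X} i a
            ... | inj₁ Li | _       = inj₁ (inj₁ Li)
            ... | inj₂ Hi | yes i≡a = inj₁ (inj₂ i≡a)
            ... | inj₂ Hi | no  i≢a = inj₂ (Hi , i≢a)

        -- `h b` is above `c`, hence outside `J`, and not right of `f`, hence left of `J`: it is the
        -- required `y`. The lower part cannot use `f`, since `f` would then be left of `h b`.
        found : ∀ {s b} → Lo κ s → h s ≡ c → Hi κ b → b ≢ a → ¬ lt τ X f (h b) → ⊥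
        found {s} {b} Ls hs≡c Hb b≢a f≮hb = k
          ( h , lo-copy , (λ s Ls → lo-place s Ls)
          , left c∉J (subst (λ i → ¬ lt τ X f i) hs≡c (before X Ls))
          , h b , c<h Ls hs≡c Hb b≢a X
          , left (above∉J (c<h Ls hs≡c Hb b≢a Y)) f≮hb )
          where
          lo-place : ∀ s → Lo κ s → SouthWest τ J (h s) ⊎ h s ≡ c
          lo-place t Lt with where-lo Lt
          ... | inj₂ (inj₁ ht≡c)  = inj₂ ht≡c
          ... | inj₂ (inj₂ ht-sw) = inj₁ ht-sw
          ... | inj₁ ht≡f = ⊥-elim (f≮hb (subst (λ i → lt τ X i (h b)) ht≡f
                              (old-pair (lo-old t Lt) (≢⇒old b≢a) (lo<hi κ X Lt Hb))))

-- Growth of every proper interval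

module _ {A n} {π : Conf A} (κ : Cut π) (Lo-two : Two (Lo κ)) (Hi-two : Two (Hi κ))
         {τ : Conf (Fin n)} {J : Fin n → Set}
         (avoids : Avoids π τ) (interval : Interval τ J) (J-two : Two J) where

  -- The corner lemma and its mirror image in the antidiagonal supply a copy of
  -- the lower part near the south-west of J and a copy of the upper part near
  -- the north-east of J that fit together.
  growth-if-above : ∀ {z} → (∀ {j} → J j → lt τ Y j z) → DoubleNegation (Growth π τ J)
  growth-if-above {z} above stuck =
    least τ Y (λ i → ∀ {j} → J j → lt τ Y j i) above λ (c , c-above , c-lowest) →
    Stuck.corner avoids interval J-two stuck κ Lo-two Hi-two c c-above c-lowest
    λ (e , copy , place , c-left , y , c<y , y-left) →
    -- `y` shows that there are points left of `J`; `d` is the rightmost of them.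
    least (rotate τ) X (λ i → ∀ {j} → J j → lt τ X i j) y-left λ (d , d-left , d-rightmost) →
    -- Transposition followed by the half-turn is the reflection in the antidiagonal. It makes `d`
    -- the lowest point above `J` and exchanges the two parts.
    Stuck.corner {π = rotate (transpose π)} {rotate (transpose τ)}
      (λ e copy → avoids e λ { X → copy Y ; Y → copy X })
      (rotateInterval {τ = transpose τ} (transposeInterval {τ = τ} interval)) J-two
      (stuck ∘ transposeGrowth ∘ rotateGrowth)
      (rotateCut (transposeCut κ)) Hi-two Lo-two d d-left d-rightmost
    λ (e′ , copy′ , place′ , d-above , _) →
    no-glue τ avoids κ e e′ copy (λ { X Hi Hj → copy′ Y Hj Hi ; Y Hi Hj → copy′ X Hj Hi })
      λ ax {i} {j} Li Hj → cross (place i Li) (place′ j Hj)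
                             c-lowest c-left c<y d-rightmost d-above y-left ax
    where
    j₀ : Fin n
    j₀ = proj₁ J-two
    Jj₀ : J j₀
    Jj₀ = proj₁ (proj₂ (proj₂ J-two))
    -- `J` separates the two copies except near `c` and `d`. A point left of `J` is at most `d` in
    -- the `X` order, a point above `J` is at least `c` in the `Y` order, and where equality could
    -- occur, comparison in the other order excludes it.
    cross : ∀ {c d y u v} →
            SouthWest τ J u ⊎ u ≡ c → SouthWest (rotate (transpose τ)) J v ⊎ v ≡ d →
            (∀ {i} → (∀ {j} → J j → lt τ Y j i) → ¬ lt τ Y i c) →
            (∀ {j} → J j → lt τ X c j) → lt τ X c y →
            (∀ {i} → (∀ {j} → J j → lt τ X i j) → ¬ lt τ X d i) →
            (∀ {j} → J j → lt τ Y j d) → (∀ {j} → J j → lt τ X y j) →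
            ∀ ax → lt τ ax u v
    cross (inj₁ sw) (inj₁ ne) _ _ _ _ _ _ X = <-trans τ (sw X Jj₀) (ne Y Jj₀)
    cross (inj₁ sw) (inj₁ ne) _ _ _ _ _ _ Y = <-trans τ (sw Y Jj₀) (ne X Jj₀)
    cross (inj₁ sw) (inj₂ refl) _ _ _ _ d-above _ Y = <-trans τ (sw Y Jj₀) (d-above Jj₀)
    cross (inj₁ sw) (inj₂ refl) _ _ _ d-rightmost d-above _ X with ≮⇒≥ τ (d-rightmost (sw X))
    ... | inj₁ refl = ⊥-elim (asym τ (sw Y Jj₀) (d-above Jj₀))
    ... | inj₂ u<d  = u<d
    cross (inj₂ refl) (inj₁ ne) _ c-left _ _ _ _ X = <-trans τ (c-left Jj₀) (ne Y Jj₀)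
    cross (inj₂ refl) (inj₁ ne) c-lowest c-left _ _ _ _ Y with ≮⇒≥ τ (c-lowest (ne X))
    ... | inj₁ refl = ⊥-elim (asym τ (c-left Jj₀) (ne Y Jj₀))
    ... | inj₂ c<v  = c<v
    cross (inj₂ refl) (inj₂ refl) _ _ c<y d-rightmost _ y-left X =
      <-≮-trans τ c<y (d-rightmost y-left)
    cross (inj₂ refl) (inj₂ refl) c-lowest _ c<y d-rightmost d-above y-left Y
      with ≮⇒≥ τ (c-lowest d-above)
    ... | inj₁ refl = ⊥-elim (<-irrefl τ refl (<-≮-trans τ c<y (d-rightmost y-left)))
    ... | inj₂ c<d  = c<d

module _ {A n} {π : Conf A} (κ : Cut π) (Lo-two : Two (Lo κ)) (Hi-two : Two (Hi κ))
         {τ : Conf (Fin n)} {J : Fin n → Set}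
         (avoids : Avoids π τ) (interval : Interval τ J) (J-two : Two J) where

  growth : ∀ {w} → ¬ J w → DoubleNegation (Growth π τ J)
  growth {w} w∉J = [ below , above ]′ w-side
    where
    j₀ : Fin n
    j₀ = proj₁ J-two
    Jj₀ : J j₀
    Jj₀ = proj₁ (proj₂ (proj₂ J-two))
    w-side : lt τ Y w j₀ ⊎ lt τ Y j₀ w
    w-side with compare τ {Y} w j₀
    ... | tri< w<j _ _ = inj₁ w<j
    ... | tri≈ _ w≡j _ = ⊥-elim (w∉J (subst J (sym w≡j) Jj₀))
    ... | tri> _ _ j<w = inj₂ j<w
    above : lt τ Y j₀ w → DoubleNegation (Growth π τ J)
    above j<w = growth-if-above κ Lo-two Hi-two avoids interval J-two
                  (above-all τ interval w∉J Jj₀ j<w)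
    below : lt τ Y w j₀ → DoubleNegation (Growth π τ J)
    below w<j stuck = growth-if-above {π = rotate π} (rotateCut κ) Hi-two Lo-two {τ = rotate τ}
                  (λ e copy → avoids e λ ax → copy ax) (rotateInterval {τ = τ} interval) J-two
                  (below-all τ interval w∉J Jj₀ w<j) (stuck ∘ rotateGrowth)

-- Hulls of pairs and extensions

-- The smallest interval containing `p` and `q`. A nonempty configuration is simple precisely when
-- `Full` holds for any two distinct points.
data Hull {A} (τ : Conf A) (p q : A) : A → Set where
  left    : Hull τ p q p
  right   : Hull τ p q q
  between : ∀ ax {a b z} → Hull τ p q a → Hull τ p q b →
            lt τ ax a z → lt τ ax z b → Hull τ p q z

Full : ∀ {A} → Conf A → A → A → Set
Full τ p q = ∀ z → Hull τ p q z

hull-least : ∀ {A} {τ : Conf A} {U : A → Set} {p q} → Interval τ U → U p → U q →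
             ∀ {z} → Hull τ p q z → U z
hull-least interval Up Uq left  = Up
hull-least interval Up Uq right = Uq
hull-least interval Up Uq (between ax Ha Hb a<z z<b) =
  interval ax (hull-least interval Up Uq Ha) (hull-least interval Up Uq Hb) a<z z<b

hull-map : ∀ {A B} {τ : Conf A} {τ′ : Conf B} {e p q} → Copy τ τ′ e →
           ∀ {z} → Hull τ p q z → Hull τ′ (e p) (e q) (e z)
hull-map copy left  = left
hull-map copy right = right
hull-map copy (between ax Ha Hb a<z z<b) =
  between ax (hull-map copy Ha) (hull-map copy Hb) (copy ax a<z) (copy ax z<b)

-- `keeps` lets the pairs be treated one after another: a pair that generates everything still does
-- so after later insertions.
record Extension {A m} (π : Conf A) (τ : Conf (Fin m)) : Set₁ where
  field
    {size} : ℕ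
    conf   : Conf (Fin size)
    avoids : Avoids π conf
    emb    : Fin m → Fin size
    copy   : Copy τ conf emb
    keeps  : ∀ {a b} → Full τ a b → Full conf (emb a) (emb b)
open Extension

ext-refl : ∀ {A m} {π : Conf A} {τ : Conf (Fin m)} → Avoids π τ → Extension π τ
ext-refl {τ = τ} avoids = record
  { conf = τ ; avoids = avoids ; emb = id ; copy = λ _ → id ; keeps = id }

ext-trans : ∀ {A m} {π : Conf A} {τ : Conf (Fin m)} (x : Extension π τ) →
            Extension π (conf x) → Extension π τ
ext-trans x x′ = record
  { conf = conf x′ ; avoids = avoids x′ ; emb = emb x′ ∘ emb x
  ; copy = λ ax → copy x′ ax ∘ copy x ax ; keeps = keeps x′ ∘ keeps x }

corner-place : ∀ {n} (τ : Conf (Fin n)) → Place τ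
corner-place τ = record
  { Before = λ { X _ → ⊥ ; Y _ → ⊤ }
  ; before? = λ { X _ → no λ () ; Y _ → yes tt }
  ; closed = λ { X _ () ; Y _ _ → tt } }

-- 1 ⊖ τ
pad : ∀ {n} → Conf (Fin n) → Conf (Fin (suc n))
pad τ = insert τ (corner-place τ)

module _ {A} {π : Conf A} (κ : Cut π) (Lo-two : Two (Lo κ)) (Hi-two : Two (Hi κ)) where

  -- Each growth step moves one of the points listed by r into the hull.
  separate : ∀ k {m} (τ : Conf (Fin m)) → Avoids π τ → ∀ {p q} → p ≢ q →
             (r : Fin k → Fin m) → (∀ z → Hull τ p q z ⊎ ∃ λ i → r i ≡ z) →
             DoubleNegation (Σ (Extension π τ) λ x → Full (conf x) (emb x p) (emb x q))
  separate zero τ avoids p≢q r outside k =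
    k (ext-refl avoids , λ z → [ id , (λ ()) ]′ (outside z))
  separate (suc n) {m} τ avoids {p} {q} p≢q r outside k = decide (Hull τ p q) λ H? →
    decide-full (Finₚ.all? H?) H?
    where
    grow : Growth π τ (Hull τ p q) → ⊥
    grow g = continue gains
      where
      open Growth g renaming (avoids to avoids′)
      old-hull : ∀ {z} → Hull τ p q z → Hull grown (suc p) (suc q) (suc z)
      old-hull = hull-map {τ = τ} {τ′ = grown} old
      new-hull : Hull grown (suc p) (suc q) zero
      new-hull = let (ax , j , j′ , Hj , Hj′ , j<0 , 0<j′) = cuts in
                 between ax (old-hull Hj) (old-hull Hj′) j<0 0<j′
      x : Extension π τ
      x = record
        { conf = grown ; avoids = avoids′ ; emb = suc ; copy = old
        ; keeps = λ {a} {b} full → full′ a b full }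
        where
        full′ : ∀ a b → Full τ a b → Full grown (suc a) (suc b)
        full′ a b full (suc z) = hull-map {τ = τ} {τ′ = grown} old (full z)
        -- The new point lies between two old ones, so it is in any hull that contains all old
        -- points.
        full′ a b full zero =
          let (ax , j , j′ , _ , _ , j<0 , 0<j′) = cuts in
          between ax (full′ a b full (suc j)) (full′ a b full (suc j′)) j<0 0<j′
      continue : (∃ λ ax → ∃ λ z → ∃ λ j → ¬ Hull τ p q z × Hull τ p q j ×
                  ((lt grown ax (suc j) (suc z) × lt grown ax (suc z) zero) ⊎
                   (lt grown ax zero (suc z) × lt grown ax (suc z) (suc j)))) → ⊥
      continue (ax , z , j , z∉H , Hj , btw) with outside z
      ... | inj₁ Hz = z∉H Hz
      ... | inj₂ (i₀ , refl) =
        separate n grown avoids′ (p≢q ∘ suc-injective) (suc ∘ r ∘ punchIn i₀) outside′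
          λ (x′ , full) → k (ext-trans x x′ , full)
        where
        z-hull : Hull grown (suc p) (suc q) (suc (r i₀))
        z-hull = [ (λ (j<z , z<0) → between ax (old-hull Hj) new-hull j<z z<0)
                 , (λ (0<z , z<j) → between ax new-hull (old-hull Hj) 0<z z<j) ]′ btw
        outside′ : ∀ w → Hull grown (suc p) (suc q) w ⊎ ∃ λ i → suc (r (punchIn i₀ i)) ≡ w
        outside′ zero = inj₁ new-hull
        outside′ (suc w) with outside w
        ... | inj₁ Hw = inj₁ (old-hull Hw)
        ... | inj₂ (i , refl) with i₀ F.≟ i
        ...   | yes refl = inj₁ z-hull
        ...   | no i₀≢i  = inj₂ (punchOut i₀≢i , cong (suc ∘ r) (punchIn-punchOut i₀≢i))
    decide-full : Dec (Full τ p q) → (∀ z → Dec (Hull τ p q z)) → ⊥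
    decide-full (yes full) _  = k (ext-refl avoids , full)
    decide-full (no ¬full) H? =
      let (w , w∉H) = ¬∀⟶∃¬ m (Hull τ p q) H? ¬full in
      growth κ Lo-two Hi-two avoids between (p , q , left , right , p≢q) w∉H grow

  separate-all : ∀ {s} (ps : List (Fin s × Fin s)) {m} (τ : Conf (Fin m)) → Avoids π τ →
                 (e : Fin s → Fin m) → Injective _≡_ _≡_ e →
                 DoubleNegation (Σ (Extension π τ) λ x →
                   All (λ (p , q) → p ≢ q → Full (conf x) (emb x (e p)) (emb x (e q))) ps)
  separate-all [] τ avoids e e-inj k = k (ext-refl avoids , [])
  separate-all ((p , q) ∷ ps) {m} τ avoids₀ e e-inj k with p F.≟ q
  ... | yes p≡q = separate-all ps τ avoids₀ e e-inj λ (x , all) →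
                  k (x , (λ p≢q → ⊥-elim (p≢q p≡q)) ∷ all)
  ... | no p≢q =
    -- With `id` as the list, every point counts as possibly outside the hull.
    separate m τ avoids₀ (p≢q ∘ e-inj) id (λ z → inj₂ (z , refl)) λ (x , full) →
    separate-all ps (conf x) (avoids x) (emb x ∘ e)
      (e-inj ∘ copy-injective {π = τ} {conf x} (copy x)) λ (x′ , all) →
    k (ext-trans x x′ , (λ _ → keeps x′ full) ∷ all)

  -- The new point has nothing to its left and nothing above it, whereas in `π` each point of the
  -- lower part has a point above it and each point of the upper part has one to its left.
  pad-avoids : ∀ {n} {τ : Conf (Fin n)} → Avoids π τ → Avoids π (pad τ)
  pad-avoids {n} {τ} avoids g copy = avoids-old (g s) refl
    where
    s = proj₁ Lo-two
    Ls = proj₁ (proj₂ (proj₂ Lo-two))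
    b = proj₁ Hi-two
    Hb = proj₁ (proj₂ (proj₂ Hi-two))
    nothing-left : ∀ {i} → ¬ lt (pad τ) X i zero
    nothing-left {zero}  ()
    nothing-left {suc i} ()
    nothing-above : ∀ {i} → ¬ lt (pad τ) Y zero i
    nothing-above {zero} ()
    nothing-above {suc i} 0<i = 0<i tt
    unused : ∀ a → g a ≢ zero
    unused a ga≡0 with side κ a
    ... | inj₁ La = nothing-above {g b}
                     (subst (λ i → lt (pad τ) Y i (g b)) ga≡0 (copy Y (lo<hi κ Y La Hb)))
    ... | inj₂ Ha = nothing-left {g s}
                     (subst (lt (pad τ) X (g s)) ga≡0 (copy X (lo<hi κ X Ls Ha)))
    -- The split on `g s` serves to supply an old point `d` as the default for `drop`.
    avoids-old : ∀ i → g s ≡ i → ⊥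
    avoids-old zero    gs≡0 = unused s gs≡0
    avoids-old (suc d) _ = avoids (drop d ∘ g)
      λ ax → drop-copyOn π (corner-place τ) d (λ _ → ⊤) g (λ i _ → unused i) copy ax tt tt

-- Removal of points

pullback : ∀ {A B} (f : A → B) → Injective _≡_ _≡_ f → Conf B → Conf A
pullback f f-inj τ = record
  { lt  = λ ax i j → lt τ ax (f i) (f j)
  ; sto = λ ax → record
    { isStrictPartialOrder = record
      { isEquivalence = isEquivalence
      ; irrefl = λ i≡j → <-irrefl τ (cong f i≡j)
      ; trans = <-trans τ
      ; <-resp-≈ = (λ { refl p → p }) , (λ { refl p → p })
      }
    ; compare = cmp ax
    }
  }
  where
  cmp : ∀ ax i j → Tri (lt τ ax (f i) (f j)) (i ≡ j) (lt τ ax (f j) (f i))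
  cmp ax i j with compare τ {ax} (f i) (f j)
  ... | tri< p q r = tri< p (q ∘ cong f) r
  ... | tri≈ p q r = tri≈ p (f-inj q) r
  ... | tri> p q r = tri> p (q ∘ cong f) r

remove : ∀ {m} → Fin (suc m) → Conf (Fin (suc m)) → Conf (Fin m)
remove y = pullback (punchIn y) (punchIn-injective y _ _)

module _ {m} (τ : Conf (Fin (suc m))) {J : Fin (suc m) → Set} (J? : ∀ i → Dec (J i))
         (interval : Interval τ J) {y y′} (Jy : J y) (Jy′ : J y′) (y≢y′ : y ≢ y′) where

  -- Let `M` be the new hull. If `M` misses `J`, it stays an interval when `y` is restored, since
  -- points of `M` around `y` would also surround `y′`; but the old hull contains `y`. If `M` meets
  -- `J`, their union is an interval of `τ`, hence everything, so a point missed by `M` would be in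
  -- `J`. Then the complement of `J` would be an interval containing `a` and `b` but not `y`.
  full-remove : ∀ {a b} → ¬ J a → ¬ J b → Full τ a b →
                ∀ {p q} → Full τ (punchIn y p) (punchIn y q) →
                DoubleNegation (Full (remove y τ) p q)
  full-remove {a} {b} a∉J b∉J full-ab {p} {q} full k =
    decide M λ M? → finish M? (any? λ i → M? i ×-dec J? (punchIn y i))
    where
    M : Fin m → Set
    M = Hull (remove y τ) p q

    InM : Fin (suc m) → Set
    InM z = ∃ λ i → M i × punchIn y i ≡ z

    ≢y⇒old : ∀ {z} → y ≢ z → ∃ λ i → punchIn y i ≡ z
    ≢y⇒old y≢z = punchOut y≢z , punchIn-punchOut y≢z

    disjoint⇒⊥ : ¬ (∃ λ i → M i × J (punchIn y i)) → ⊥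
    disjoint⇒⊥ disjoint =
      let (_ , _ , eq) = hull-least {τ = τ} M-interval
                           (p , left , refl) (q , right , refl) (full y)
      in punchInᵢ≢i y _ eq
      where
      M-interval : Interval τ InM
      M-interval ax {z = z} (i , Mi , refl) (j , Mj , refl) i<z z<j with y F.≟ z
      ... | no y≢z with ≢y⇒old y≢z
      ...   | k , refl = k , between ax Mi Mj i<z z<j , refl
      M-interval ax {z = z} (i , Mi , refl) (j , Mj , refl) i<y y<j | yes refl with ≢y⇒old y≢y′
      ...   | k , refl = ⊥-elim (disjoint (k , between ax Mi Mj
                (below-all τ interval (λ Ji → disjoint (i , Mi , Ji)) Jy i<y Jy′)
                (above-all τ interval (λ Jj → disjoint (j , Mj , Jj)) Jy y<j Jy′) , Jy′))

    overlap⇒full : ∀ {i₀} → M i₀ → J (punchIn y i₀) → ∀ {w} → ¬ ¬ M w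
    overlap⇒full {i₀} Mi₀ Ji₀ {w} w∉M = hull-least {τ = τ} outside-interval a∉J b∉J (full-ab y) Jy
      where
      union-interval : Interval τ (λ z → J z ⊎ InM z)
      union-interval ax {z = z} Ua Ub a<z z<b with J? z
      ... | yes Jz = inj₁ Jz
      ... | no z∉J with ≢y⇒old {z} (λ { refl → z∉J Jy }) | Ua | Ub
      ...   | i , refl | inj₁ Ja | inj₁ Jb = inj₁ (interval ax Ja Jb a<z z<b)
      ...   | i , refl | inj₁ Ja | inj₂ (_ , Mb , refl) =
              inj₂ (i , between ax Mi₀ Mb (above-all τ interval z∉J Ja a<z Ji₀) z<b , refl)
      ...   | i , refl | inj₂ (_ , Ma , refl) | inj₁ Jb =
              inj₂ (i , between ax Ma Mi₀ a<z (below-all τ interval z∉J Jb z<b Ji₀) , refl)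
      ...   | i , refl | inj₂ (_ , Ma , refl) | inj₂ (_ , Mb , refl) =
              inj₂ (i , between ax Ma Mb a<z z<b , refl)

      covered : ∀ {z} → ¬ J z → InM z
      covered {z} z∉J = [ (λ Jz → ⊥-elim (z∉J Jz)) , id ]′
        (hull-least {τ = τ} union-interval (inj₂ (p , left , refl)) (inj₂ (q , right , refl)) (full z))

      Jw : ¬ ¬ J (punchIn y w)
      Jw w∉J with covered w∉J
      ... | i , Mi , eq with punchIn-injective y _ _ eq
      ...   | refl = w∉M Mi

      -- Otherwise J lies between two points of M, so that all of J is in M.
      outside-interval : Interval τ (λ z → ¬ J z)
      outside-interval ax {a} {b} a∉J b∉J a<z z<b Jz with covered a∉J | covered b∉J
      ... | i , Mi , refl | j , Mj , refl = Jw λ Jw →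
        w∉M (between ax Mi Mj (below-all τ interval a∉J Jz a<z Jw) (above-all τ interval b∉J Jz z<b Jw))

    finish : (∀ i → Dec (M i)) → Dec (∃ λ i → M i × J (punchIn y i)) → ⊥
    finish M? (no disjoint) = disjoint⇒⊥ disjoint
    finish M? (yes (_ , Mi , Ji)) = k λ w → decidable-stable (M? w) (overlap⇒full Mi Ji)

record Simple {A s} (π : Conf A) (σ : Conf (Fin s)) : Set₁ where
  field
    {size} : ℕ
    conf   : Conf (Fin size)
    avoids : Avoids π conf
    emb    : Fin s → Fin size
    copy   : Copy σ conf emb
    full   : ∀ p q → p ≢ q → Full conf p q

-- A proper hull contains at most one of the marked points e i; one of its
-- other points can be removed.
simplify : ∀ {A s} {π : Conf A} {σ : Conf (Fin (suc (suc (suc s))))} {m} (τ : Conf (Fin m)) →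
           Avoids π τ → (e : Fin (suc (suc (suc s))) → Fin m) → Copy σ τ e →
           (∀ i j → i ≢ j → Full τ (e i) (e j)) → DoubleNegation (Simple π σ)
simplify {m = zero} τ avoids e copy full k with () ← e zero
simplify {A} {s} {π} {σ} {suc m} τ avoids e copy full k =
  ¬¬-excluded-middle {A = ∃ λ u → ∃ λ u′ → u ≢ u′ × ¬ Full τ u u′} λ where
    (yes (u , u′ , u≢u′ , ¬full)) → decide (Hull τ u u′) λ H? → proper u≢u′ H? (¬∀⟶∃¬ _ _ H? ¬full)
    (no all-full) → ¬¬-all (λ p → ¬¬-all λ q → full′ all-full p q) λ full → k record
      { conf = τ ; avoids = avoids ; emb = e ; copy = copy ; full = full }
  where
  full′ : ¬ (∃ λ u → ∃ λ u′ → u ≢ u′ × ¬ Full τ u u′) →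
          ∀ p q → DoubleNegation (p ≢ q → Full τ p q)
  full′ all-full p q k with p F.≟ q
  ... | yes p≡q = k λ p≢q → ⊥-elim (p≢q p≡q)
  ... | no p≢q  = all-full (p , q , p≢q , λ full → k λ _ → full)

  proper : ∀ {u u′} → u ≢ u′ → (∀ z → Dec (Hull τ u u′ z)) → ∃ (λ w → ¬ Hull τ u u′ w) → ⊥
  proper {u} {u′} u≢u′ H? (w , w∉J) =
    choose (any? λ i → e i F.≟ u) (any? λ i → e i F.≟ u′)
    where
    J = Hull τ u u′

    -- Two marked points in `J` would generate everything, including `w`.
    one-mark : ∀ {i j} → i ≢ j → J (e i) → ¬ J (e j)
    one-mark i≢j Ji Jj = w∉J (hull-least {τ = τ} between Ji Jj (full _ _ i≢j w))

    -- Of three marked points at least two are outside `J`; this is what the padding provides for.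
    outside : ∃ λ i → ∃ λ j → i ≢ j × ¬ J (e i) × ¬ J (e j)
    outside with H? (e zero) | H? (e (suc zero))
    ... | yes J₀ | _ = suc zero , suc (suc zero) , (λ ()) , one-mark (λ ()) J₀ , one-mark (λ ()) J₀
    ... | no J₀  | yes J₁ = zero , suc (suc zero) , (λ ()) , J₀ , one-mark (λ ()) J₁
    ... | no J₀  | no J₁  = zero , suc zero , (λ ()) , J₀ , J₁

    delete : ∀ {y y′} → J y → J y′ → y ≢ y′ → ¬ (∃ λ i → e i ≡ y) → ⊥
    delete {y} {y′} Jy Jy′ y≢y′ unmarked =
      ¬¬-all (λ i → ¬¬-all λ j → still-full i j) λ full →
      simplify {π = π} {σ} (remove y τ) avoids′ e′ copy′ full k
      where
      y≢e : ∀ i → y ≢ e i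
      y≢e i y≡ei = unmarked (i , sym y≡ei)
      e′ : Fin (suc (suc (suc s))) → Fin m
      e′ i = punchOut (y≢e i)
      back : ∀ i → punchIn y (e′ i) ≡ e i
      back i = punchIn-punchOut (y≢e i)
      copy′ : Copy σ (remove y τ) e′
      copy′ ax {i} {j} i<j = subst₂ (lt τ ax) (sym (back i)) (sym (back j)) (copy ax i<j)
      avoids′ : Avoids π (remove y τ)
      avoids′ g gcopy = avoids (punchIn y ∘ g) λ ax → gcopy ax
      still-full : ∀ i j → DoubleNegation (i ≢ j → Full (remove y τ) (e′ i) (e′ j))
      still-full i j k with i F.≟ j
      ... | yes i≡j = k λ i≢j → ⊥-elim (i≢j i≡j)
      ... | no i≢j  =
        let (a , b , a≢b , a∉J , b∉J) = outside in
        full-remove τ H? between Jy Jy′ y≢y′ a∉J b∉J (full a b a≢b)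
          (subst₂ (Full τ) (sym (back i)) (sym (back j)) (full i j i≢j))
          λ full → k λ _ → full

    -- `u` and `u′` cannot both be marked, so one of them can be deleted.
    choose : Dec (∃ λ i → e i ≡ u) → Dec (∃ λ i → e i ≡ u′) → ⊥
    choose (no unmarked) _ = delete left right u≢u′ unmarked
    choose (yes _) (no unmarked) = delete right left (u≢u′ ∘ sym) unmarked
    choose (yes (i , ei≡u)) (yes (j , ej≡u′)) =
      one-mark (λ { refl → u≢u′ (trans (sym ei≡u) ej≡u′) })
        (subst J (sym ei≡u) left) (subst J (sym ej≡u′) right)

-- Permutations and configurations

permConf : (σ : Perm) → Conf (Fin (len σ))
permConf σ = record { lt = order ; sto = λ { X → Finₚ.<-isStrictTotalOrder ; Y → by-value } }
  where
  order : Axis → Fin (len σ) → Fin (len σ) → Set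
  order X i j = i F.< j
  order Y i j = fun σ i F.< fun σ j
  byValue : Conf (Fin (len σ))
  byValue = pullback (fun σ) (inj σ)
    record { lt = λ _ → F._<_ ; sto = λ _ → Finₚ.<-isStrictTotalOrder }
  by-value : IsStrictTotalOrder _≡_ (order Y)
  by-value = sto byValue Y

≼⇒copy : ∀ {α β} → ((e , _) : α ≼ β) → Copy (permConf α) (permConf β) e
≼⇒copy (e , increasing , values) X = increasing _ _
≼⇒copy (e , increasing , values) Y = proj₁ (values _ _)

copy⇒≼ : ∀ {α β e} → Copy (permConf α) (permConf β) e → α ≼ β
copy⇒≼ {α} {β} {e} copy =
  e , (λ _ _ → copy X) , λ _ _ → copy Y , copy-reflects {π = permConf α} {permConf β} copy {Y}

av⇒avoids : ∀ {π σ} → Av π σ → Avoids (permConf π) (permConf σ)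
av⇒avoids {π} {σ} av e copy = av (copy⇒≼ {π} {σ} copy)

module _ {n} (f : Fin n → Fin n) (f-inj : Injective _≡_ _≡_ f) where

  injective⇒surjective : ∀ k → ∃ λ i → f i ≡ k
  injective⇒surjective k with any? (λ i → f i F.≟ k)
  ... | yes hit = hit
  ... | no miss = ⊥-elim (squeeze k f-inj λ i k≡fi → miss (i , sym k≡fi))
    where
    squeeze : ∀ {n} {f : Fin n → Fin n} k → Injective _≡_ _≡_ f → ¬ (∀ i → k ≢ f i)
    squeeze {suc n} k f-inj k≢f = ℕ.1+n≰n (Finₚ.injective⇒≤ {f = λ i → punchOut (k≢f i)}
      λ eq → f-inj (Finₚ.punchOut-injective (k≢f _) (k≢f _) eq))

full-range : ∀ {n} (a b : Fin n) → (∀ (k : Fin n) → a F.≤ k × k F.≤ b) → toℕ a ≡ 0 × toℕ b ≡ n ∸ 1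
full-range {suc m} a b covers =
  let (a≤first , _) = covers zero
      (_ , last≤b)  = covers (fromℕ m) in
  ℕ.n≤0⇒n≡0 a≤first ,
  ℕ.≤-antisym (s≤s⁻¹ (Finₚ.toℕ<n b)) (subst (_≤ toℕ b) (Finₚ.toℕ-fromℕ m) last≤b)

module _ {n} (τ : Conf (Fin n)) where

  private
    below : Axis → Fin n → Subset n
    below ax i = Vec.tabulate λ j → does (_<?_ τ {ax} j i)

    ∈below⁺ : ∀ {ax i j} → lt τ ax j i → j ∈ below ax i
    ∈below⁺ {ax} {i} {j} j<i = Vecₚ.lookup⇒[]= j _
      (trans (Vecₚ.lookup∘tabulate _ j) (dec-true (_<?_ τ j i) j<i))

    ∈below⁻ : ∀ {ax i j} → j ∈ below ax i → lt τ ax j i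
    ∈below⁻ {ax} {i} {j} j∈ = decode (_<?_ τ j i)
      (trans (sym (Vecₚ.lookup∘tabulate _ j)) (Vecₚ.[]=⇒lookup j∈))
      where
      decode : ∀ {P : Set} (P? : Dec P) → does P? ≡ true → P
      decode (yes p) _ = p

    i∉below : ∀ {ax i} → i ∉ below ax i
    i∉below {ax} i∈ = <-irrefl τ {ax} refl (∈below⁻ i∈)

    size<n : ∀ ax i → ∣ below ax i ∣ < n
    size<n ax i = subst (∣ below ax i ∣ <_) (Subsetₚ.∣⊤∣≡n n)
      (Subsetₚ.p⊂q⇒∣p∣<∣q∣ ((λ _ → Subsetₚ.∈⊤) , i , Subsetₚ.∈⊤ , i∉below))

  -- Counting the smaller points turns an abstract order into the standard one; `i` itself is not
  -- counted, which keeps the value below `n`.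
  rank : Axis → Fin n → Fin n
  rank ax i = fromℕ< (size<n ax i)

  rank-mono : ∀ ax {i j} → lt τ ax i j → rank ax i F.< rank ax j
  rank-mono ax {i} {j} i<j =
    subst₂ _<_ (sym (toℕ-fromℕ< (size<n ax i))) (sym (toℕ-fromℕ< (size<n ax j)))
      (Subsetₚ.p⊂q⇒∣p∣<∣q∣ ((λ k∈ → ∈below⁺ (<-trans τ (∈below⁻ k∈) i<j)) , i , ∈below⁺ i<j , i∉below))

  rank-injective : ∀ ax → Injective _≡_ _≡_ (rank ax)
  rank-injective ax {i} {j} eq with compare τ {ax} i j
  ... | tri< i<j _ _ = ⊥-elim (Finₚ.<-irrefl eq (rank-mono ax i<j))
  ... | tri≈ _ i≡j _ = i≡j
  ... | tri> _ _ j<i = ⊥-elim (Finₚ.<-irrefl (sym eq) (rank-mono ax j<i))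

  private
    at : Fin n → Fin n
    at k = proj₁ (injective⇒surjective (rank X) (rank-injective X) k)

    rank-at : ∀ k → rank X (at k) ≡ k
    rank-at k = proj₂ (injective⇒surjective (rank X) (rank-injective X) k)

    at-rank : ∀ i → at (rank X i) ≡ i
    at-rank i = rank-injective X (rank-at (rank X i))

  standardize : Perm
  standardize = perm n (rank Y ∘ at) λ {i} {j} eq →
    trans (sym (rank-at i)) (trans (cong (rank X) (rank-injective Y eq)) (rank-at j))

  copy-standardize : Copy τ (permConf standardize) (rank X)
  copy-standardize X i<j = rank-mono X i<j
  copy-standardize Y {i} {j} i<j =
    subst₂ (λ i j → rank Y i F.< rank Y j) (sym (at-rank i)) (sym (at-rank j)) (rank-mono Y i<j)

  standardize-copy : Copy (permConf standardize) τ at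
  standardize-copy ax {k} {l} k<l = copy-reflects {π = τ} {permConf standardize} copy-standardize {ax}
    (subst₂ (lt (permConf standardize) ax) (sym (rank-at k)) (sym (rank-at l)) k<l)

  standardize-full : (∀ p q → p ≢ q → Full τ p q) →
                     ∀ p q → p ≢ q → Full (permConf standardize) p q
  standardize-full full p q p≢q z =
    subst (Hull ν p q) (rank-at z)
      (subst₂ (λ p q → Hull ν p q (rank X (at z))) (rank-at p) (rank-at q)
        (hull-map {τ = τ} {τ′ = ν} {e = rank X} copy-standardize (full (at p) (at q) at-p≢at-q (at z))))
    where
    ν : Conf (Fin n)
    ν = permConf standardize
    at-p≢at-q : at p ≢ at q
    at-p≢at-q eq = p≢q (trans (sym (rank-at p)) (trans (cong (rank X) eq) (rank-at q)))

-- An interval block is an interval of the configuration; if its ends are distinct, it contains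
-- their hull and hence every position.
full⇒simple : ∀ ν → 1 ≤ len ν → (∀ p q → p ≢ q → Full (permConf ν) p q) → IsSimple ν
full⇒simple ν 1≤len full = 1≤len , blocks
  where
  blocks : ∀ a b → IsIntervalBlock ν a b → (a ≡ b) ⊎ ((toℕ a ≡ 0) × (toℕ b ≡ len ν ∸ 1))
  blocks a b (a≤b , block) with a F.≟ b
  ... | yes a≡b = inj₁ a≡b
  ... | no a≢b  = inj₂ (full-range a b λ k →
        hull-least {τ = permConf ν} interval (ℕ.≤-refl , a≤b) (a≤b , ℕ.≤-refl) (full a b a≢b k))
    where
    interval : Interval (permConf ν) (λ (k : Fin (len ν)) → a F.≤ k × k F.≤ b)
    interval X (a≤i , _) (_ , j≤b) i<z z<j =
      ℕ.≤-trans a≤i (ℕ.<⇒≤ i<z) , ℕ.≤-trans (ℕ.<⇒≤ z<j) j≤b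
    interval Y {i} {j} {z} (a≤i , i≤b) (a≤j , j≤b) i<z z<j =
      block i j z a≤i i≤b a≤j j≤b (ℕ.<⇒≤ i<z) (ℕ.<⇒≤ z<j)

-- Direct sums of permutations and the theorem

module _ (λ' ρ : Perm) where

  private
    m = len λ'
    n = len ρ
    π = permConf (λ' ⊕ ρ)

    value-↑ˡ : ∀ p → fun (λ' ⊕ ρ) (p ↑ˡ n) ≡ fun λ' p ↑ˡ n
    value-↑ˡ p rewrite Finₚ.splitAt-↑ˡ m p n = refl

    value-↑ʳ : ∀ q → fun (λ' ⊕ ρ) (m ↑ʳ q) ≡ m ↑ʳ fun ρ q
    value-↑ʳ q rewrite Finₚ.splitAt-↑ʳ m n q = refl

    ↑ˡ<↑ʳ : ∀ (p : Fin m) (q : Fin n) → p ↑ˡ n F.< m ↑ʳ q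
    ↑ˡ<↑ʳ p q = subst₂ _<_ (sym (Finₚ.toℕ-↑ˡ p n)) (sym (Finₚ.toℕ-↑ʳ m q))
      (ℕ.<-≤-trans (Finₚ.toℕ<n p) (ℕ.m≤m+n m (toℕ q)))

  ⊕-cut : Cut π
  ⊕-cut = record
    { Lo = λ i → ∃ λ p → p ↑ˡ n ≡ i
    ; Hi = λ i → ∃ λ q → m ↑ʳ q ≡ i
    ; side = side′
    ; lo<hi = λ where
        X (p , refl) (q , refl) → ↑ˡ<↑ʳ p q
        Y (p , refl) (q , refl) →
          subst₂ F._<_ (sym (value-↑ˡ p)) (sym (value-↑ʳ q)) (↑ˡ<↑ʳ (fun λ' p) (fun ρ q))
    }
    where
    side′ : ∀ i → (∃ λ p → p ↑ˡ n ≡ i) ⊎ (∃ λ q → m ↑ʳ q ≡ i)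
    side′ i with splitAt m i in eq
    ... | inj₁ p = inj₁ (p , Finₚ.splitAt⁻¹-↑ˡ eq)
    ... | inj₂ q = inj₂ (q , Finₚ.splitAt⁻¹-↑ʳ eq)

two-points : ∀ {n} → 2 ≤ n → ∃ λ (i : Fin n) → ∃ λ j → i ≢ j
two-points (s≤s (s≤s _)) = zero , suc zero , λ ()

theorem3p2 : (λ' ρ : Perm) → 2 ≤ len λ' → 2 ≤ len ρ →
    ¬ Deflatable (Av (λ' ⊕ ρ))
theorem3p2 λ' ρ 2≤λ 2≤ρ (D , D-class , D⊆Av , (σ , σ∈Av , σ∉D) , closure) =
  separate-all κ Lo-two Hi-two (cartesianProduct (allFin _) (allFin _)) padded padded-avoids id id
    λ (x , all) →
  simplify {π = π} {padded} (conf x) (avoids x) (emb x) (copy x)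
      (λ i j → All.lookup all (∈-cartesianProduct⁺ (∈-allFin i) (∈-allFin j)))
    λ s → let module S = Simple s
              ν = standardize S.conf
              σ≼ν : σ ≼ ν
              -- The shift by three skips the padding points.
              σ≼ν = copy⇒≼ {σ} {ν} {λ i → rank S.conf X (S.emb (suc (suc (suc i))))}
                      λ ax {i} {j} i<j → copy-standardize S.conf ax
                        (S.copy ax {suc (suc (suc i))} {suc (suc (suc j))} i<j)
              ν∈Av : Av (λ' ⊕ ρ) ν
              ν∈Av π≼ν = S.avoids _ λ ax → standardize-copy S.conf ax ∘ ≼⇒copy {λ' ⊕ ρ} {ν} π≼ν ax
          in
  -- `ν` is a simple permutation of the class and contains itself, so the closure condition puts it
  -- in `D`, and with it `σ`.
  σ∉D (D-class σ ν σ≼ν (closure ν ν∈Av ν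
    (full⇒simple ν (ℕ.≤-trans (s≤s z≤n) (Finₚ.toℕ<n (S.emb zero))) (standardize-full S.conf S.full))
    (id , (λ _ _ → id) , λ _ _ → id , id)))
  where
  π = permConf (λ' ⊕ ρ)
  κ = ⊕-cut λ' ρ
  Lo-two : Two (Lo κ)
  Lo-two = let (p , q , p≢q) = two-points 2≤λ in
    p ↑ˡ len ρ , q ↑ˡ len ρ , (p , refl) , (q , refl) , p≢q ∘ Finₚ.↑ˡ-injective (len ρ) p q
  Hi-two : Two (Hi κ)
  Hi-two = let (p , q , p≢q) = two-points 2≤ρ in
    len λ' ↑ʳ p , len λ' ↑ʳ q , (p , refl) , (q , refl) , p≢q ∘ Finₚ.↑ʳ-injective (len λ') p q
  padded : Conf (Fin (suc (suc (suc (len σ)))))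
  padded = pad (pad (pad (permConf σ)))
  padded-avoids : Avoids π padded
  padded-avoids = pad-avoids κ Lo-two Hi-two {τ = pad (pad (permConf σ))}
    (pad-avoids κ Lo-two Hi-two {τ = pad (permConf σ)}
      (pad-avoids κ Lo-two Hi-two {τ = permConf σ} (av⇒avoids {λ' ⊕ ρ} {σ} σ∈Av)))
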